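{- If $X$ is a countable, second countable topological space, then $\mathcal{M}(X)$, as a subset of $\mathcal{P}(X)$, is not $\boldsymbol{\Sigma}^0_1$-complete, not $\boldsymbol{\Delta}^0_2$-sharp, and not $\boldsymbol{\Pi}^0_2$-complete.
   Context: "Countable" means countably infinite (the paper writes "at most countable" when finite sets are allowed). For a topological space $X$, a subset $A\subseteq X$ is dense in an open set $U$ if $U\subseteq\overline{A}$, and codense in $U$ if $U\subseteq\overline{X\setminus A}$. A subset $A\subseteq X$ is monitorable if for every non-empty open set $U\subseteq X$ either $A$ is not dense in $U$ or $A$ is not codense in $U$. $\mathcal{M}(X)\subseteq\mathcal{P}(X)$ denotes the family of monitorable subsets of $X$. The powerset $\mathcal{P}(X)$ is identified with $2^X$ via characteristic functions and carries the product topology (with $2=\{0,1\}$ discrete); for countable $X$ it is homeomorphic to the Cantor space. $\boldsymbol{\Sigma}^0_\alpha,\boldsymbol{\Pi}^0_\alpha$ are the usual classes of the Borel hierarchy ($\boldsymbol{\Sigma}^0_1$ = open sets, $\boldsymbol{\Pi}^0_\alpha$ = complements of $\boldsymbol{\Sigma}^0_\alpha$ sets, $\boldsymbol{\Sigma}^0_\alpha$ = at most countable unions of sets in $\bigcup_{\beta<\alpha}\boldsymbol{\Pi}^0_\beta$ for $\alpha\geq 2$), and $\boldsymbol{\Delta}^0_\alpha=\boldsymbol{\Sigma}^0_\alpha\cap\boldsymbol{\Pi}^0_\alpha$. For a boldface pointclass $\boldsymbol{\Gamma}$ and a Polish space $Z$, a set $A\subseteq Z$ is $\boldsymbol{\Gamma}$-hard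 if for every zero-dimensional Polish space $Y$ and every $B\in\boldsymbol{\Gamma}(Y)$ there is a continuous $f:Y\to Z$ with $B=f^{ -1}(A)$; $A$ is $\boldsymbol{\Gamma}$-complete if $A\in\boldsymbol{\Gamma}(Z)$ and $A$ is $\boldsymbol{\Gamma}$-hard. For $\alpha\ge2$, $A\subseteq Z$ is $\boldsymbol{\Delta}^0_\alpha$-sharp if $A\in\boldsymbol{\Delta}^0_\alpha(Z)\setminus\bigcup_{\beta<\alpha}(\boldsymbol{\Sigma}^0_\beta(Z)\cup\boldsymbol{\Pi}^0_\beta(Z))$. -}

module Defs where

open import Data.Bool.Base using (Bool; true)
open import Data.List.Base using (List; []; _++_)
open import Data.List.Relation.Unary.All using (All; [])
import Data.List.Relation.Unary.All.Properties as All
open import Data.Nat.Base as ℕ using (ℕ)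
open import Data.Product.Base using (Σ; ∃-syntax; _×_; _,_)
open import Data.Rational.Base as ℚ using (ℚ; 0ℚ; 1ℚ)
import Data.Rational.Properties as ℚ
open import Data.Sum.Base using (_⊎_)
open import Data.Unit.Polymorphic.Base using (⊤)
open import Function.Base using (id; _∘_)
open import Function.Bundles using (_⇔_)
open import Function.Metric.Structures using (IsGeneralMetric)
open import Level using (Level; 0ℓ; suc; _⊔_)
open import Relation.Binary.PropositionalEquality.Core using (_≡_)
open import Relation.Nullary.Negation.Core using (¬_)
open import Relation.Unary using (Pred; _∈_; _⊆_; _≐_; _≬_; _∩_; _⊢_; ∁; ⋃; Satisfiable)

-- The theory developed here is meant to be read classically: the theorem takes
-- excluded middle and function extensionality as hypotheses.  `Set` plays the
-- role of the class of sets, and `_⊎_` and `Σ` are the classical "or" and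
-- "exists".

------------------------------------------------------------------------
-- Topological spaces

-- ℓ is the universe level of the subsets.  Under excluded middle the choice of
-- ℓ, and of the levels of `Open` and of the index set I, is immaterial; ℓ is
-- kept variable only because `Monitorable` quantifies over all open sets and
-- so raises the level by one.
record TopologicalSpace (ℓ : Level) : Set (suc ℓ) where
  field
    Carrier : Set
    Open    : Pred (Pred Carrier ℓ) ℓ
    -- Subsets are predicates, identified up to mutual inclusion.
    open-≐  : {U V : Pred Carrier ℓ} → U ≐ V → Open U → Open V
    open-U  : Open (λ _ → ⊤)
    open-∩  : {U V : Pred Carrier ℓ} → Open U → Open V → Open (U ∩ V)
    -- I may be empty, so the empty set is open.
    open-⋃  : (I : Set ℓ) (U : I → Pred Carrier ℓ) → (∀ i → Open (U i)) → Open (⋃ I U)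

module _ {ℓ : Level} (X : TopologicalSpace ℓ) where
  open TopologicalSpace X

  Closure : {a : Level} → Pred Carrier a → Pred Carrier (suc ℓ ⊔ a)
  Closure A x = ∀ U → Open U → x ∈ U → U ≬ A

  DenseIn : {a : Level} → Pred Carrier a → Pred Carrier ℓ → Set (suc ℓ ⊔ a)
  DenseIn A U = U ⊆ Closure A

  CodenseIn : {a : Level} → Pred Carrier a → Pred Carrier ℓ → Set (suc ℓ ⊔ a)
  CodenseIn A U = U ⊆ Closure (∁ A)

  Monitorable : {a : Level} → Pred Carrier a → Set (suc ℓ ⊔ a)
  Monitorable A = ∀ U → Open U → Satisfiable U → ¬ DenseIn A U ⊎ ¬ CodenseIn A U

  -- A basis enumerated by ℕ, possibly with repetitions and with empty members,
  -- so finite bases are included.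
  SecondCountable : Set (suc ℓ)
  SecondCountable = Σ (ℕ → Pred Carrier ℓ) λ B → (∀ n → Open (B n)) ×
    (∀ U → Open U → ∀ {x} → x ∈ U → ∃[ n ] x ∈ B n × B n ⊆ U)

  Clopen : Pred Carrier ℓ → Set ℓ
  Clopen U = Open U × Open (∁ U)

  ZeroDimensional : Set (suc ℓ)
  ZeroDimensional = ∀ U → Open U → ∀ {x} → x ∈ U → ∃[ V ] Clopen V × x ∈ V × V ⊆ U

Continuous : {ℓ : Level} (Y Z : TopologicalSpace ℓ) →
             (TopologicalSpace.Carrier Y → TopologicalSpace.Carrier Z) → Set (suc ℓ)
Continuous Y Z f = ∀ U → Open Z U → Open Y (f ⊢ U)
  where open TopologicalSpace

------------------------------------------------------------------------
-- Non-negative reals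

-- A non-negative real x is given by its upper Dedekind cut {q ∈ ℚ ∣ x < q}.
record ℝ≥0 : Set₁ where
  field
    cut       : Pred ℚ 0ℓ
    positive  : ∀ {q} → q ∈ cut → 0ℚ ℚ.< q
    inhabited : Satisfiable cut
    upward    : ∀ {p q} → p ∈ cut → p ℚ.≤ q → q ∈ cut
    rounded   : ∀ {q} → q ∈ cut → ∃[ p ] p ∈ cut × p ℚ.< q

open ℝ≥0

infix 4 _<ℚ_ _≈_ _≤_
infixl 6 _+_

_<ℚ_ : ℝ≥0 → ℚ → Set
x <ℚ q = q ∈ cut x

_≤_ : ℝ≥0 → ℝ≥0 → Set
x ≤ y = cut y ⊆ cut x

_≈_ : ℝ≥0 → ℝ≥0 → Set
x ≈ y = cut x ≐ cut y

0ᴿ : ℝ≥0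
0ᴿ = record
  { cut       = λ q → 0ℚ ℚ.< q
  ; positive  = id
  ; inhabited = 1ℚ , ℚ.positive⁻¹ 1ℚ
  ; upward    = ℚ.<-≤-trans
  ; rounded   = λ 0<q → let p , 0<p , p<q = ℚ.<-dense 0<q in p , 0<p , p<q
  }

_+_ : ℝ≥0 → ℝ≥0 → ℝ≥0
x + y = record
  { cut       = λ q → ∃[ r ] ∃[ s ] r ∈ cut x × s ∈ cut y × r ℚ.+ s ℚ.≤ q
  ; positive  = λ (r , s , x<r , y<s , r+s≤q) →
      ℚ.<-≤-trans (ℚ.+-mono-< (positive x x<r) (positive y y<s)) r+s≤q
  ; inhabited = let r , x<r = inhabited x ; s , y<s = inhabited y in
      r ℚ.+ s , r , s , x<r , y<s , ℚ.≤-refl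
  ; upward    = λ (r , s , x<r , y<s , r+s≤p) p≤q →
      r , s , x<r , y<s , ℚ.≤-trans r+s≤p p≤q
  ; rounded   = λ (r , s , x<r , y<s , r+s≤q) → let r′ , x<r′ , r′<r = rounded x x<r in
      r′ ℚ.+ s , (r′ , s , x<r′ , y<s , ℚ.≤-refl) , ℚ.<-≤-trans (ℚ.+-monoˡ-< s r′<r) r+s≤q
  }

------------------------------------------------------------------------
-- Polish spaces

module _ {A : Set} (d : A → A → ℝ≥0) where

  IsMetric : Set₁
  IsMetric = IsGeneralMetric _≡_ _≈_ _≤_ 0ᴿ _+_ d

  Cauchy : (ℕ → A) → Set
  Cauchy x = ∀ ε → 0ℚ ℚ.< ε → ∃[ N ] (∀ m n → N ℕ.≤ m → N ℕ.≤ n → d (x m) (x n) <ℚ ε)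

  _ConvergesTo_ : (ℕ → A) → A → Set
  x ConvergesTo l = ∀ ε → 0ℚ ℚ.< ε → ∃[ N ] (∀ n → N ℕ.≤ n → d (x n) l <ℚ ε)

  CompleteMetric : Set
  CompleteMetric = ∀ x → Cauchy x → ∃[ l ] x ConvergesTo l

  MetricOpen : {ℓ : Level} → Pred A ℓ → Set ℓ
  MetricOpen U = ∀ {x} → x ∈ U → ∃[ ε ] 0ℚ ℚ.< ε × (∀ {y} → d x y <ℚ ε → y ∈ U)

-- Finite (in particular empty) sets are included.
AtMostCountable : {A : Set} → Pred A 0ℓ → Set
AtMostCountable {A} D =
  Σ (A → ℕ) λ f → ∀ {x y} → x ∈ D → y ∈ D → f x ≡ f y → x ≡ y

module _ {ℓ : Level} (X : TopologicalSpace ℓ) where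
  open TopologicalSpace X

  Separable : Set (suc ℓ)
  Separable = Σ (Pred Carrier 0ℓ) λ D → AtMostCountable D × (∀ x → x ∈ Closure X D)

  CompletelyMetrizable : Set (suc ℓ)
  CompletelyMetrizable = Σ (Carrier → Carrier → ℝ≥0) λ d →
    IsMetric d × CompleteMetric d × (∀ U → Open U ⇔ MetricOpen d U)

  Polish : Set (suc ℓ)
  Polish = Separable × CompletelyMetrizable

------------------------------------------------------------------------
-- Borel hierarchy at finite levels, and boldface pointclasses

module _ {ℓ : Level} (X : TopologicalSpace ℓ) where
  open TopologicalSpace X

  -- Level 0 is empty.  In `countable-⋃` the sets B i are Π⁰ₘ with m < n, i.e.
  -- their complements are Σ⁰ₘ.  Unions over ℕ cover all at most countable
  -- unions, since B may repeat and ∅ is Π⁰₁.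
  data Σ⁰ : ℕ → Pred (Pred Carrier ℓ) (suc ℓ) where
    isOpen      : ∀ {A} → Open A → Σ⁰ 1 A
    countable-⋃ : ∀ {n A} (B : ℕ → Pred Carrier ℓ) → 2 ℕ.≤ n →
                  (∀ i → ∃[ m ] m ℕ.< n × Σ⁰ m (∁ (B i))) →
                  A ≐ ⋃ ℕ B → Σ⁰ n A

  Π⁰ : ℕ → Pred (Pred Carrier ℓ) (suc ℓ)
  Π⁰ n A = Σ⁰ n (∁ A)

  Δ⁰ : ℕ → Pred (Pred Carrier ℓ) (suc ℓ)
  Δ⁰ n = Σ⁰ n ∩ Π⁰ n

  -- Only meaningful for n ≥ 2.
  Δ⁰-Sharp : ℕ → Pred (Pred Carrier ℓ) (suc ℓ)
  Δ⁰-Sharp n A = Δ⁰ n A × (∀ m → m ℕ.< n → ¬ (Σ⁰ m A ⊎ Π⁰ m A))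

Pointclass : (ℓ : Level) → Set (suc (suc ℓ))
Pointclass ℓ = (Y : TopologicalSpace ℓ) → Pred (Pred (TopologicalSpace.Carrier Y) ℓ) (suc ℓ)

module _ {ℓ : Level} (Γ : Pointclass ℓ) (Z : TopologicalSpace ℓ) where
  open TopologicalSpace

  Hard : Pred (Pred (Carrier Z) ℓ) (suc ℓ)
  Hard A = ∀ (Y : TopologicalSpace ℓ) → Polish Y → ZeroDimensional Y →
    ∀ B → Γ Y B → Σ (Carrier Y → Carrier Z) λ f → Continuous Y Z f × B ≐ (f ⊢ A)

  Complete : Pred (Pred (Carrier Z) ℓ) (suc ℓ)
  Complete A = Γ Z A × Hard A

------------------------------------------------------------------------
-- The powerset as a space, and the family of monitorable sets

-- The product topology on 2^A: a basic neighbourhood of f consists of all g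
-- that agree with f on a finite list of coordinates.
2^_ : {ℓ : Level} → Set → TopologicalSpace ℓ
2^ A = record
  { Carrier = A → Bool
  ; Open    = λ U → ∀ {f} → f ∈ U → ∃[ xs ] (∀ {g} → All (λ x → f x ≡ g x) xs → g ∈ U)
  ; open-≐  = λ (U⊆V , V⊆U) U-open f∈V → let xs , h = U-open (V⊆U f∈V) in xs , U⊆V ∘ h
  ; open-U  = λ _ → [] , λ _ → _
  ; open-∩  = λ U-open V-open (f∈U , f∈V) →
      let xs , h = U-open f∈U ; ys , k = V-open f∈V in
      xs ++ ys , λ f≡g → h (All.++⁻ˡ xs f≡g) , k (All.++⁻ʳ xs f≡g)
  ; open-⋃  = λ I U U-open (i , f∈Uᵢ) → let xs , h = U-open i f∈Uᵢ in xs , λ f≡g → i , h f≡g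
  }

module _ {ℓ : Level} (X : TopologicalSpace ℓ) where
  open TopologicalSpace X

  𝒫 : TopologicalSpace (suc ℓ)
  𝒫 = 2^ Carrier

  𝓜 : Pred (Carrier → Bool) (suc ℓ)
  𝓜 A = Monitorable X (λ x → A x ≡ true)

{-# OPTIONS --safe #-}
module Submission where

-- Call a nonempty open set an atom if it has no smaller nonempty open subset.
-- If every nonempty open set contains an atom, then A is monitorable iff no atom
-- meets both A and its complement, so 𝓜(X) is closed; a closed set cannot be
-- hard for a class containing an open set that is not closed.  Otherwise some
-- nonempty open U contains no atom.  Then every nonempty open V ⊆ U has infinitely
-- many points x with {x} nowhere dense, and every finite set of such points is
-- monitorable.  So if 𝓜(X) were a G_δ, then, as in the Baire category theorem, a
-- set built from finite sets of such points could be put into 𝓜(X) while being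
-- made dense and codense in U.

open import Defs
open import Axiom.ExcludedMiddle using (ExcludedMiddle)
open import Axiom.Extensionality.Propositional using (Extensionality)
open import Data.Bool.Base using (Bool; true)
open import Data.Empty using (⊥-elim)
open import Data.Integer.Base using (+_; -[1+_]; +<+)
open import Data.List.Base using (List; []; _∷_; _++_)
open import Data.List.Membership.Propositional using () renaming (_∈_ to _∈ₗ_)
open import Data.List.Membership.Propositional.Properties using (∈-++⁺ˡ; ∈-++⁺ʳ)
open import Data.List.Relation.Unary.All as All using (All; []; _∷_)
open import Data.List.Relation.Unary.Any using (here; there)
open import Data.Nat.Base as ℕ using (ℕ; zero; z≤n; s≤s; ≤′-refl; ≤′-step)
import Data.Nat.Properties as ℕ
open import Data.Nat.Coprimality using (1-coprimeTo)
open import Data.Product.Base using (∃-syntax; _×_; _,_; -,_; proj₁; proj₂)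
open import Data.Rational.Base as ℚ using (ℚ; mkℚ; 0ℚ; 1ℚ; *<*)
import Data.Rational.Properties as ℚ
open import Data.Sum.Base using (_⊎_; inj₁; inj₂; [_,_]′)
open import Data.Unit.Base using (⊤)
open import Function.Base using (id; _∘_)
open import Function.Bundles using (_⤖_; mk⇔)
open import Level using (Level; Lift; lift; lower; 0ℓ; suc)
open import Relation.Binary.Definitions using (Reflexive; Transitive)
open import Relation.Binary.PropositionalEquality.Core using (_≡_; _≢_; refl; sym; subst)
import Relation.Binary.PropositionalEquality.Properties as ≡
open import Relation.Nullary.Decidable using
  (Dec; yes; no; does; map′; decidable-stable; dec-true; does-⇔)
open import Relation.Nullary.Negation.Core using (¬_; contradiction)
open import Relation.Unary using (Pred; _∈_; _⊆_; _≐_; _≬_; _∩_; ∁; ⋃; Satisfiable)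

open ℝ≥0

private variable
  ℓ : Level

-- The Borel hierarchy

module _ {Y : TopologicalSpace ℓ} where
  open TopologicalSpace Y

  Σ⁰₁⇒open : ∀ {A} → Σ⁰ Y 1 A → Open A
  Σ⁰₁⇒open (isOpen A-open)             = A-open
  Σ⁰₁⇒open (countable-⋃ _ (s≤s ()) _ _)

  Σ⁰₂⇒Fσ : ∀ {A} → Σ⁰ Y 2 A → ∃[ F ] (∀ i → Open (∁ (F i))) × A ≐ ⋃ ℕ F
  Σ⁰₂⇒Fσ (countable-⋃ F _ F-Π⁰ A≐⋃F) = F , (λ i → closed (F-Π⁰ i)) , A≐⋃F
    where
    closed : ∀ {A} → ∃[ m ] m ℕ.< 2 × Σ⁰ Y m A → Open A
    closed (0 , _ , countable-⋃ _ () _ _)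
    closed (1 , _ , A-Σ⁰) = Σ⁰₁⇒open A-Σ⁰
    closed (ℕ.suc (ℕ.suc _) , s≤s (s≤s ()) , _)

  Σ⁰₁⇒Π⁰₂ : ExcludedMiddle ℓ → ∀ {A} → Σ⁰ Y 1 A → Π⁰ Y 2 A
  Σ⁰₁⇒Π⁰₂ em {A} A-Σ⁰₁ = countable-⋃ (λ _ → ∁ A) ℕ.≤-refl
    (λ _ → 1 , ℕ.≤-refl ,
      isOpen (open-≐ (contradiction , decidable-stable em) (Σ⁰₁⇒open A-Σ⁰₁)))
    ((λ ¬a → 0 , ¬a) , proj₂)

-- Metric topologies

module _ {A : Set} (d : A → A → ℝ≥0) where

  metricTopology : (ℓ : Level) → TopologicalSpace ℓ
  metricTopology ℓ = record
    { Carrier = A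
    ; Open    = MetricOpen d
    ; open-≐  = λ (U⊆V , V⊆U) U-open x∈V →
        let ε , 0<ε , ball⊆U = U-open (V⊆U x∈V) in ε , 0<ε , U⊆V ∘ ball⊆U
    ; open-U  = λ _ → 1ℚ , ℚ.positive⁻¹ 1ℚ , _
    ; open-∩  = λ U-open V-open (x∈U , x∈V) →
        let ε , 0<ε , ball⊆U = U-open x∈U ; δ , 0<δ , ball⊆V = V-open x∈V in
        ε ℚ.⊓ δ , ⊓-glb-< 0<ε 0<δ , λ {y} x-y →
          ball⊆U (upward (d _ y) x-y (ℚ.p⊓q≤p ε δ)) , ball⊆V (upward (d _ y) x-y (ℚ.p⊓q≤q ε δ))
    ; open-⋃  = λ I U U-open (i , x∈Uᵢ) →
        let ε , 0<ε , ball⊆Uᵢ = U-open i x∈Uᵢ in ε , 0<ε , λ x-y → i , ball⊆Uᵢ x-y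
    }
    where
    ⊓-glb-< : ∀ {p q r} → p ℚ.< q → p ℚ.< r → p ℚ.< q ℚ.⊓ r
    ⊓-glb-< {p} {q} {r} p<q p<r with ℚ.⊓-sel q r
    ... | inj₁ eq = subst (p ℚ.<_) (sym eq) p<q
    ... | inj₂ eq = subst (p ℚ.<_) (sym eq) p<r

  -- Every point of an ultrametric ball is a centre of it, so the balls are clopen.
  ultrametric⇒zeroDimensional :
    (∀ {x q} → 0ℚ ℚ.< q → d x x <ℚ q) → (∀ {x y q} → d x y <ℚ q → d y x <ℚ q) →
    (∀ {x y z q} → d x y <ℚ q → d y z <ℚ q → d x z <ℚ q) →
    ZeroDimensional (metricTopology ℓ)
  ultrametric⇒zeroDimensional d-refl d-sym d-trans U U-open {x} x∈U =
    let ε , 0<ε , ball⊆U = U-open x∈U in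
    (λ y → Lift _ (d x y <ℚ ε)) ,
    ( (λ (lift x-y) → ε , 0<ε , λ y-z → lift (d-trans x-y y-z))
    , (λ x≁y → ε , 0<ε , λ y-z (lift x-z) → x≁y (lift (d-trans x-z (d-sym y-z)))) ) ,
    lift (d-refl 0<ε) , λ (lift x-y) → ball⊆U x-y

-- A convergent sequence

-- The values are 0, 1/2, 1/3, ...; starting at 1/2 keeps them below 1, so that 1 lies in every cut
-- of `distance`.
weight : ℕ → ℚ
weight zero      = 0ℚ
weight (ℕ.suc n) = mkℚ (+ 1) (ℕ.suc n) (1-coprimeTo (2 ℕ.+ n))

weight<1 : ∀ n → weight n ℚ.< 1ℚ
weight<1 zero      = ℚ.positive⁻¹ 1ℚ
weight<1 (ℕ.suc n) = *<* (+<+ (s≤s (s≤s z≤n)))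

0<weight : ∀ n → 0ℚ ℚ.< weight (ℕ.suc n)
0<weight n = ℚ.positive⁻¹ (weight (ℕ.suc n))

weight-small : ∀ q → 0ℚ ℚ.< q → ∃[ n ] weight (ℕ.suc n) ℚ.< q
weight-small (mkℚ (+ 0) d _) (*<* (+<+ ()))
-- For `q` = (n+1)/(d+1), the weight 1/(d+2) is below 1/(d+1), hence below `q`.
weight-small (mkℚ (+ ℕ.suc n) d _) _ = d , *<* (+<+ (s≤s (s≤s
  (ℕ.≤-trans (ℕ.≤-reflexive (ℕ.+-identityʳ d)) (ℕ.m≤m+n d _)))))
weight-small (mkℚ -[1+ n ] d _) (*<* ())

-- The ultrametric max (weight x) (weight y) for x ≢ y; its points ℕ.suc n are
-- isolated and converge to 0.
distance : ℕ → ℕ → ℝ≥0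
distance x y = record
  { cut       = λ q → 0ℚ ℚ.< q × (x ≡ y ⊎ weight x ℚ.< q × weight y ℚ.< q)
  ; positive  = proj₁
  ; inhabited = 1ℚ , ℚ.positive⁻¹ 1ℚ , inj₂ (weight<1 x , weight<1 y)
  ; upward    = λ where
      (0<p , inj₁ x≡y) p≤q → ℚ.<-≤-trans 0<p p≤q , inj₁ x≡y
      (0<p , inj₂ (x<p , y<p)) p≤q →
        ℚ.<-≤-trans 0<p p≤q , inj₂ (ℚ.<-≤-trans x<p p≤q , ℚ.<-≤-trans y<p p≤q)
  ; rounded   = λ where
      (0<q , inj₁ x≡y) → let p , 0<p , p<q = ℚ.<-dense 0<q in p , (0<p , inj₁ x≡y) , p<q
      (0<q , inj₂ (x<q , y<q)) →
        let p , m<p , p<q = ℚ.<-dense (⊔-lub-< 0<q (⊔-lub-< x<q y<q))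
            wx = weight x ; wy = weight y
            xy<p = ℚ.≤-<-trans (ℚ.p≤q⊔p 0ℚ (wx ℚ.⊔ wy)) m<p in
        p , ( ℚ.≤-<-trans (ℚ.p≤p⊔q 0ℚ (wx ℚ.⊔ wy)) m<p
            , inj₂ (ℚ.≤-<-trans (ℚ.p≤p⊔q wx wy) xy<p , ℚ.≤-<-trans (ℚ.p≤q⊔p wx wy) xy<p)) ,
        p<q
  }
  where
  ⊔-lub-< : ∀ {p q r} → p ℚ.< r → q ℚ.< r → p ℚ.⊔ q ℚ.< r
  ⊔-lub-< {p} {q} {r} p<r q<r with ℚ.⊔-sel p q
  ... | inj₁ eq = subst (ℚ._< r) (sym eq) p<r
  ... | inj₂ eq = subst (ℚ._< r) (sym eq) q<r

distance-refl : ∀ {x q} → 0ℚ ℚ.< q → distance x x <ℚ q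
distance-refl 0<q = 0<q , inj₁ refl

distance-sym : ∀ {x y q} → distance x y <ℚ q → distance y x <ℚ q
distance-sym (0<q , inj₁ x≡y)         = 0<q , inj₁ (sym x≡y)
distance-sym (0<q , inj₂ (x<q , y<q)) = 0<q , inj₂ (y<q , x<q)

distance-ultra : ∀ {x y z q} → distance x y <ℚ q → distance y z <ℚ q → distance x z <ℚ q
distance-ultra (_ , inj₁ refl)        y-z                  = y-z
distance-ultra x-y                    (_ , inj₁ refl)      = x-y
distance-ultra (0<q , inj₂ (x<q , _)) (_ , inj₂ (_ , z<q)) = 0<q , inj₂ (x<q , z<q)

distance-isolated : ∀ {n y} → distance (ℕ.suc n) y <ℚ weight (ℕ.suc n) → ℕ.suc n ≡ y
distance-isolated (_ , inj₁ eq)        = eq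
distance-isolated (_ , inj₂ (w<w , _)) = contradiction w<w (ℚ.<-irrefl refl)

distance-isMetric : IsMetric distance
distance-isMetric = record
  { isSemiMetric = record
    { isQuasiSemiMetric = record
      { isPreMetric = record
        { isProtoMetric = record
          { isPartialOrder = record
            { isPreorder = record
              { isEquivalence = record
                { refl  = id , id
                ; sym   = λ (p , q) → q , p
                ; trans = λ (p , q) (r , s) → r ∘ p , q ∘ s
                }
              ; reflexive = proj₂
              ; trans     = λ p q → p ∘ q
              }
            ; antisym = λ p q → q , p
            }
          ; ≈-isEquivalence = ≡.isEquivalence
          ; cong            = λ { refl refl → id , id }
          ; nonNegative     = proj₁
          }
        ; ≈⇒0 = λ { refl → proj₁ , λ 0<q → 0<q , inj₁ refl }
        }
      ; 0⇒≈ = λ (_ , small) → indiscernible small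
      }
    ; sym = λ x y → distance-sym , distance-sym
    }
  ; triangle = λ x y z (r , s , x-y , y-z , r+s≤q) →
      let 0<r = positive (distance x y) x-y ; 0<s = positive (distance y z) y-z in
      distance-ultra
        (upward (distance x y) x-y (ℚ.≤-trans (p≤p+q 0<s) r+s≤q))
        (upward (distance y z) y-z (ℚ.≤-trans (q≤p+q 0<r) r+s≤q))
  }
  where
  p≤p+q : ∀ {p q} → 0ℚ ℚ.< q → p ℚ.≤ p ℚ.+ q
  p≤p+q {p} {q} 0<q =
    subst (ℚ._≤ p ℚ.+ q) (ℚ.+-identityʳ p) (ℚ.+-monoʳ-≤ p (ℚ.<⇒≤ 0<q))

  q≤p+q : ∀ {p q} → 0ℚ ℚ.< p → q ℚ.≤ p ℚ.+ q
  q≤p+q {p} {q} 0<p = subst (ℚ._≤ p ℚ.+ q) (ℚ.+-identityˡ q) (ℚ.+-monoˡ-≤ q (ℚ.<⇒≤ 0<p))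

  indiscernible : ∀ {x y} → (∀ {q} → 0ℚ ℚ.< q → distance x y <ℚ q) → x ≡ y
  indiscernible {zero}    {zero}    small = refl
  indiscernible {zero}    {ℕ.suc n} small =
    sym (distance-isolated (distance-sym (small (0<weight n))))
  indiscernible {ℕ.suc n} {y}       small = distance-isolated (small (0<weight n))

-- If no tail is constant, the limit is 0: a term at distance at least ε from 0 equals every term
-- closer to it than ε.
distance-complete : ExcludedMiddle 0ℓ → CompleteMetric distance
distance-complete em x cauchy with em {∃[ N ] ∃[ l ] (∀ n → N ℕ.≤ n → x n ≡ l)}
... | yes (N , l , const) = l , λ ε 0<ε → N , λ n N≤n → 0<ε , inj₁ (const n N≤n)
... | no ¬const = 0 , λ ε 0<ε → let N , close = cauchy ε 0<ε in
  N , λ n N≤n → decidable-stable em λ far → ¬const (N , x n , λ m N≤m →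
    stuck far (close m n N≤m N≤n))
  where
  stuck : ∀ {l m ε} → ¬ distance l 0 <ℚ ε → distance m l <ℚ ε → m ≡ l
  stuck far (_ , inj₁ m≡l)         = m≡l
  stuck far (0<ε , inj₂ (_ , l<ε)) = contradiction (0<ε , inj₂ (l<ε , 0<ε)) far

convergentSequence : (ℓ : Level) → TopologicalSpace ℓ
convergentSequence = metricTopology distance

convergentSequence-polish : ExcludedMiddle 0ℓ → Polish (convergentSequence ℓ)
convergentSequence-polish em =
  ( (λ _ → ⊤)
  , (id , λ _ _ → id)
  , λ x U U-open x∈U → x , x∈U , _ ) ,
  distance , distance-isMetric , distance-complete em , λ U → mk⇔ id id

convergentSequence-zeroDimensional : ZeroDimensional (convergentSequence ℓ)
convergentSequence-zeroDimensional =
  ultrametric⇒zeroDimensional distance distance-refl distance-sym distance-ultra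

-- The test set for hardness: it is open, but not closed, since 0 is a limit of its points.
Isolated : Pred ℕ ℓ
Isolated n = Lift _ (n ≢ 0)

isolated-Σ⁰₁ : Σ⁰ (convergentSequence ℓ) 1 Isolated
isolated-Σ⁰₁ = isOpen λ {x} → neighbourhood {x = x}
  where
  neighbourhood : MetricOpen distance (Isolated {ℓ})
  neighbourhood {x = zero}    (lift 0≢0) = contradiction refl 0≢0
  neighbourhood {x = ℕ.suc n} _          = weight (ℕ.suc n) , 0<weight n , λ d<w →
    lift λ { refl → contradiction (distance-isolated d<w) λ () }

isolated-not-closed : ¬ MetricOpen distance (∁ (Isolated {ℓ}))
isolated-not-closed closed =
  let ε , 0<ε , ball⊆ = closed {x = 0} (λ (lift 0≢0) → 0≢0 refl)
      n , w<ε = weight-small ε 0<ε in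
  ball⊆ {y = ℕ.suc n} (0<ε , inj₂ (0<ε , w<ε)) (lift λ ())

-- A reduction of `Isolated` to a closed set would pull back its open complement and make `Isolated`
-- closed.
hard⇒¬closed : (Γ : Pointclass ℓ) (Z : TopologicalSpace ℓ) → ExcludedMiddle 0ℓ →
  Γ (convergentSequence ℓ) Isolated →
  ∀ {A} → Hard Γ Z A → ¬ TopologicalSpace.Open Z (∁ A)
hard⇒¬closed {ℓ} Γ Z em Γ-isolated {A} hard A-closed =
  let f , f-cts , I⊆ , ⊆I = hard (convergentSequence ℓ) (convergentSequence-polish em)
        convergentSequence-zeroDimensional Isolated Γ-isolated in
  isolated-not-closed (open-≐ ((λ ¬a i → ¬a (I⊆ i)) , (λ ¬i a → ¬i (⊆I a)))
    (f-cts (∁ A) A-closed))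
  where open TopologicalSpace (convergentSequence ℓ)

-- Monitorable sets

dec-true⁻ : ∀ {a} {A : Set a} (a? : Dec A) → does a? ≡ true → A
dec-true⁻ (yes a) _ = a

module _ (em : ExcludedMiddle (suc 0ℓ)) (X : TopologicalSpace 0ℓ) where
  open TopologicalSpace X renaming (Carrier to C)

  em₀ : ExcludedMiddle 0ℓ
  em₀ = map′ lower (lift {ℓ = suc 0ℓ}) em

  -- Atoms and nowhere dense points

  NonemptyOpen : Pred (Pred C 0ℓ) 0ℓ
  NonemptyOpen U = Open U × Satisfiable U

  Atom : Pred (Pred C 0ℓ) (suc 0ℓ)
  Atom V = NonemptyOpen V × (∀ W → NonemptyOpen W → W ⊆ V → V ⊆ W)

  -- Says that the singleton of `x` is a nowhere dense set.
  NowhereDense : Pred C (suc 0ℓ)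
  NowhereDense x = ∀ U → NonemptyOpen U → ∃[ W ] NonemptyOpen W × W ⊆ U × ¬ x ∈ W

  -- If `f` is dense and codense in `U`, an atom `V` inside `U` has a point `x` in `f` and a point
  -- `y` outside. Any `g` with the same values at `x` and `y` is dense and codense in `V`, so these
  -- two coordinates give a neighbourhood outside `𝓜 X`.
  atomic⇒𝓜-closed : (∀ U → NonemptyOpen U → ∃[ V ] Atom V × V ⊆ U) →
    TopologicalSpace.Open (𝒫 X) (∁ (𝓜 X))
  atomic⇒𝓜-closed atomic {f} f∉𝓜 =
    let U , U≠∅ , f-dense , f-codense = witness
        V , ((V-open , v , v∈V) , V-min) , V⊆U = atomic U U≠∅
        x , x∈V , fx = f-dense (V⊆U v∈V) V V-open v∈V
        y , y∈V , ¬fy = f-codense (V⊆U v∈V) V V-open v∈V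
        -- By minimality, an open set that meets the atom contains all of it.
        V⊆ : ∀ {z} → z ∈ V → ∀ O → Open O → z ∈ O → V ⊆ O
        V⊆ z∈V O O-open z∈O w∈V =
          proj₁ (V-min (O ∩ V) (open-∩ O-open V-open , -, z∈O , z∈V) proj₂ w∈V) in
    x ∷ y ∷ [] , λ { {g} (fx≡gx ∷ fy≡gy ∷ []) g∈𝓜 →
      [ (λ ¬dense → ¬dense λ z∈V O O-open z∈O →
          x , V⊆ z∈V O O-open z∈O x∈V , subst (_≡ true) fx≡gx fx)
      , (λ ¬codense → ¬codense λ z∈V O O-open z∈O →
          y , V⊆ z∈V O O-open z∈O y∈V , ¬fy ∘ subst (_≡ true) (sym fy≡gy))
      ]′ (g∈𝓜 V V-open (v , v∈V)) }
    where
    F : Pred C 0ℓ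
    F x = f x ≡ true

    witness : ∃[ U ] NonemptyOpen U × DenseIn X F U × CodenseIn X F U
    witness = decidable-stable em λ ¬∃ → f∉𝓜 λ U U-open U≠∅ →
      not-dense-or-not-codense ¬∃ U (U-open , U≠∅)
      where
      not-dense-or-not-codense : ¬ (∃[ U ] NonemptyOpen U × DenseIn X F U × CodenseIn X F U) →
        ∀ U → NonemptyOpen U → ¬ DenseIn X F U ⊎ ¬ CodenseIn X F U
      not-dense-or-not-codense ¬∃ U U≠∅ with em {DenseIn X F U}
      ... | yes dense = inj₂ λ codense → ¬∃ (U , U≠∅ , dense , codense)
      ... | no ¬dense = inj₁ ¬dense

  ¬nowhereDense : ∀ {x} → ¬ NowhereDense x →
    ∃[ O ] NonemptyOpen O × (∀ W → NonemptyOpen W → W ⊆ O → x ∈ W)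
  ¬nowhereDense ¬nd = decidable-stable em λ ¬O → ¬nd λ U U≠∅ →
    decidable-stable em λ ¬W → ¬O (U , U≠∅ , λ W W≠∅ W⊆U →
      decidable-stable em₀ λ x∉W → ¬W (W , W≠∅ , W⊆U , x∉W))

  -- If no point of V is nowhere dense, pick x ∈ V and an open O in which {x} is
  -- dense: then O ∩ V is an atom.
  atom-or-nowhereDense : ∀ {V} → NonemptyOpen V →
    (∃[ A ] Atom A × A ⊆ V) ⊎ (∃[ x ] x ∈ V × NowhereDense x)
  atom-or-nowhereDense {V} (V-open , x , x∈V) with em {∃[ x ] x ∈ V × NowhereDense x}
  ... | yes nd = inj₂ nd
  ... | no ¬nd =
    let O , O≠∅@(O-open , _) , O-dense = ¬nowhereDense λ nd → ¬nd (x , x∈V , nd)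
        x∈O = O-dense O O≠∅ id in
    inj₁ ( O ∩ V
         , ((open-∩ O-open V-open , x , x∈O , x∈V) , minimal O-open O-dense)
         , proj₂ )
    where
    minimal : ∀ {O} → Open O → (∀ W → NonemptyOpen W → W ⊆ O → x ∈ W) →
      ∀ W → NonemptyOpen W → W ⊆ O ∩ V → O ∩ V ⊆ W
    minimal {O} O-open O-dense W W≠∅@(W-open , _) W⊆ {z} (z∈O , z∈V) =
      -- The singleton of `z` is dense in some `Q`. As `Q` meets `O ∩ V`, it contains `x`, so
      -- `Q ∩ W` is a nonempty open subset of `Q` and contains `z`.
      let Q , Q≠∅@(Q-open , _) , Q-dense = ¬nowhereDense λ nd → ¬nd (z , z∈V , nd)
          z∈Q = Q-dense Q Q≠∅ id
          x∈Q = proj₁ (O-dense (Q ∩ (O ∩ V))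
                  (open-∩ Q-open (open-∩ O-open V-open) , z , z∈Q , z∈O , z∈V)
                  (proj₁ ∘ proj₂))
          x∈W = O-dense W W≠∅ (proj₁ ∘ W⊆) in
      proj₂ (Q-dense (Q ∩ W) (open-∩ Q-open W-open , x , x∈Q , x∈W) proj₁)

  -- A finite union of nowhere dense singletons is nowhere dense: the open set shrinks once for each
  -- such point of `xs`, and other points are passed over.
  avoid : ∀ xs U → NonemptyOpen U →
    ∃[ W ] NonemptyOpen W × W ⊆ U × (∀ {x} → x ∈ₗ xs → NowhereDense x → ¬ x ∈ W)
  avoid [] U U≠∅ = U , U≠∅ , id , λ ()
  avoid (x ∷ xs) U U≠∅ with em {NowhereDense x} | avoid xs U U≠∅
  ... | no ¬nd | W , W≠∅ , W⊆U , misses = W , W≠∅ , W⊆U , λ where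
    (here refl) nd → contradiction nd ¬nd
    (there x∈xs) → misses x∈xs
  ... | yes nd | W , W≠∅ , W⊆U , misses =
    let W′ , W′≠∅ , W′⊆W , x∉W′ = nd W W≠∅ in
    W′ , W′≠∅ , W⊆U ∘ W′⊆W , λ where
      (here refl) _ → x∉W′
      (there x∈xs) nd → misses x∈xs nd ∘ W′⊆W

  -- Finite sets and generic sets

  χ : Pred C 0ℓ → C → Bool
  χ A x = does (em₀ {A x})

  χ⁺ : ∀ A {x} → A x → χ A x ≡ true
  χ⁺ A = dec-true em₀

  χ⁻ : ∀ A {x} → χ A x ≡ true → A x
  χ⁻ A = dec-true⁻ em₀

  -- By `avoid`, every nonempty open set has a nonempty open part that misses all of `xs`, so the
  -- set is dense in none.
  finite-monitorable : ∀ {xs} → All NowhereDense xs → χ (_∈ₗ xs) ∈ 𝓜 X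
  finite-monitorable {xs} xs-nd U U-open U≠∅ =
    let W , (W-open , w , w∈W) , W⊆U , misses = avoid xs U (U-open , U≠∅) in
    inj₁ λ dense → let x , x∈W , χx = dense (W⊆U w∈W) W W-open w∈W in
      misses (χ⁻ (_∈ₗ xs) χx) (All.lookup xs-nd (χ⁻ (_∈ₗ xs) χx)) x∈W

  -- Cohen conditions: points of decided outside stem are kept out of the set.
  record Condition : Set₁ where
    constructor condition
    field
      stem         : List C
      decided      : List C
      nowhereDense : All NowhereDense stem

  open Condition

  record Extends (A : Pred C 0ℓ) (p : Condition) : Set where
    constructor extends
    field
      contains : ∀ {x} → x ∈ₗ stem p → x ∈ A
      avoids   : ∀ {x} → x ∈ₗ decided p → x ∈ A → x ∈ₗ stem p

  open Extends

  -- The stronger condition stands on the right: whatever extends `q` extends `p`.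
  record _≼_ (p q : Condition) : Set where
    constructor refines
    field
      stem-extends : Extends (_∈ₗ stem q) p
      decided-⊆    : ∀ {x} → x ∈ₗ decided p → x ∈ₗ decided q

  open _≼_

  extends-antitone : ∀ {A p q} → p ≼ q → Extends A q → Extends A p
  extends-antitone (refines (extends c a) d) (extends c′ a′) =
    extends (c′ ∘ c) (λ x∈d x∈A → a x∈d (a′ (d x∈d) x∈A))

  ≼-refl : Reflexive _≼_
  ≼-refl = refines (extends id (λ _ → id)) id

  ≼-trans : Transitive _≼_
  ≼-trans p≼q (refines e d) = refines (extends-antitone p≼q e) (d ∘ decided-⊆ p≼q)

  -- The Rasiowa-Sikorski construction: `A` is the union of the stems of a chain of conditions. A
  -- later stem adds no point that an earlier stage has decided to leave out.
  generic : (D : ℕ → Pred Condition (suc 0ℓ)) → (∀ n p → ∃[ q ] p ≼ q × D n q) →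
    ∃[ A ] (∀ n → ∃[ p ] D n p × Extends A p)
  generic D D-dense =
    -- Requirement `n` is met in passing from stage `n` to the next one.
    limit , λ n → chain (ℕ.suc n) , proj₂ (proj₂ (D-dense n (chain n))) , limit-extends (ℕ.suc n)
    where
    chain : ℕ → Condition
    chain zero      = condition [] [] []
    chain (ℕ.suc n) = proj₁ (D-dense n (chain n))

    chain-mono : ∀ {m n} → m ℕ.≤′ n → chain m ≼ chain n
    chain-mono ≤′-refl            = ≼-refl
    chain-mono (≤′-step {n} m≤′n) =
      ≼-trans (chain-mono m≤′n) (proj₁ (proj₂ (D-dense n (chain n))))

    limit : Pred C 0ℓ
    limit x = ∃[ n ] x ∈ₗ stem (chain n)

    limit-extends : ∀ n → Extends limit (chain n)
    limit-extends n = extends (n ,_) restrict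
      where
      restrict : ∀ {x} → x ∈ₗ decided (chain n) → x ∈ limit → x ∈ₗ stem (chain n)
      restrict x∈d (m , x∈s) with ℕ.≤-total m n
      ... | inj₁ m≤n = contains (stem-extends (chain-mono (ℕ.≤⇒≤′ m≤n))) x∈s
      ... | inj₂ n≤m = avoids (stem-extends (chain-mono (ℕ.≤⇒≤′ n≤m))) x∈d x∈s

  -- The stem is monitorable, hence in `G`, and finitely many coordinates keep it there. Adding them
  -- to the decided points forces every extension to agree with the stem on them.
  decide-open : ∀ {G} → TopologicalSpace.Open (𝒫 X) G → 𝓜 X ⊆ G →
    ∀ p → ∃[ q ] p ≼ q × (∀ A → Extends A q → χ A ∈ G)
  decide-open G-open 𝓜⊆G p@(condition S L S-nd) =
    let xs , agree⇒∈G = G-open (𝓜⊆G (finite-monitorable S-nd)) in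
    condition S (xs ++ L) S-nd ,
    refines (extends id (λ _ → id)) (∈-++⁺ʳ xs) ,
    λ A A-ext → agree⇒∈G (All.tabulate λ x∈xs →
      does-⇔ (mk⇔ (contains A-ext) (avoids A-ext (∈-++⁺ˡ x∈xs))) em₀ em₀)

  -- The atomless case

  module _ {U₀ : Pred C 0ℓ} (atomless : ∀ V → Atom V → ¬ V ⊆ U₀) where

    -- Shrinking `V` to `W` discards the nowhere dense points of `xs`; since `W` contains no atom,
    -- it still has a nowhere dense point.
    fresh : ∀ {V} → NonemptyOpen V → V ⊆ U₀ → ∀ xs →
      ∃[ x ] x ∈ V × NowhereDense x × ¬ x ∈ₗ xs
    fresh {V} V≠∅ V⊆U₀ xs with avoid xs V V≠∅
    ... | W , W≠∅ , W⊆V , misses with atom-or-nowhereDense W≠∅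
    ... | inj₁ (A , A-atom , A⊆W)  = ⊥-elim (atomless A A-atom (V⊆U₀ ∘ W⊆V ∘ A⊆W))
    ... | inj₂ (x , x∈W , x-nd)    = x , W⊆V x∈W , x-nd , λ x∈xs → misses x∈xs x-nd x∈W

    decide-dense-codense : ∀ {V} → Open V → ∀ p → ∃[ q ] p ≼ q ×
      (V ⊆ U₀ → Satisfiable V → ∀ A → Extends A q → V ≬ A × V ≬ ∁ A)
    decide-dense-codense {V} V-open p@(condition S L S-nd) with em₀ {V ⊆ U₀ × Satisfiable V}
    ... | no ¬V = p , ≼-refl , λ V⊆U₀ V≠∅ → ⊥-elim (¬V (V⊆U₀ , V≠∅))
    ... | yes (V⊆U₀ , V≠∅) =
      -- `x` must not be in `L`, where points outside the stem are already excluded; `y` must avoid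
      -- the new stem, so that deciding it keeps it out for good.
      let x , x∈V , x-nd , x∉L = fresh (V-open , V≠∅) V⊆U₀ L
          y , y∈V , _ , y∉S = fresh (V-open , V≠∅) V⊆U₀ (x ∷ S) in
      condition (x ∷ S) (y ∷ L) (x-nd ∷ S-nd) ,
      refines (extends there λ where
                 x∈L (here refl) → contradiction x∈L x∉L
                 _   (there z∈S) → z∈S)
              there ,
      λ _ _ A A-ext →
        (x , x∈V , contains A-ext (here refl)) ,
        (y , y∈V , y∉S ∘ avoids A-ext (here refl))

    atomless⇒𝓜-not-Π⁰₂ : SecondCountable X → NonemptyOpen U₀ → ¬ Π⁰ (𝒫 X) 2 (𝓜 X)
    atomless⇒𝓜-not-Π⁰₂ (B , B-open , B-basis) (U₀-open , U₀≠∅) 𝓜-Π⁰₂ with Σ⁰₂⇒Fσ 𝓜-Π⁰₂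
    ... | F , F-closed , ∁𝓜⊆⋃F , ⋃F⊆∁𝓜 =
      let A , A-meets = generic Decides decide
          meets = dense-codense A A-meets
          -- `χ A` lies in no `F n`, and the `F n` cover the complement of `𝓜 X`.
          χA∈𝓜 = decidable-stable em λ χA∉𝓜 →
            let n , χA∈F = ∁𝓜⊆⋃F χA∉𝓜 ; _ , D , A-ext = A-meets n in proj₁ (D A A-ext) χA∈F
      in
      [ (λ ¬dense → ¬dense λ z∈U₀ O O-open z∈O → proj₁ (meets z∈U₀ O O-open z∈O))
      , (λ ¬codense → ¬codense λ z∈U₀ O O-open z∈O → proj₂ (meets z∈U₀ O O-open z∈O))
      ]′ (χA∈𝓜 U₀ U₀-open U₀≠∅)
      where
      -- One requirement per `n` both escapes the closed set `F n` and splits the basic set `B n` if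
      -- that is nonempty and inside `U₀`.
      Decides : ℕ → Pred Condition (suc 0ℓ)
      Decides n p = ∀ A → Extends A p →
        ¬ χ A ∈ F n × (B n ⊆ U₀ → Satisfiable (B n) → B n ≬ A × B n ≬ ∁ A)

      decide : ∀ n p → ∃[ q ] p ≼ q × Decides n q
      decide n p =
        let q , p≼q , q∉F = decide-open (F-closed n) (λ f∈𝓜 f∈F → ⋃F⊆∁𝓜 (n , f∈F) f∈𝓜) p
            r , q≼r , r-meets = decide-dense-codense (B-open n) q in
        r , ≼-trans p≼q q≼r , λ A A-ext →
          q∉F A (extends-antitone q≼r A-ext) , λ V⊆U₀ V≠∅ → r-meets V⊆U₀ V≠∅ A A-ext

      dense-codense : ∀ A → (∀ n → ∃[ p ] Decides n p × Extends A p) →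
        ∀ {z} → z ∈ U₀ → ∀ O → Open O → z ∈ O →
        O ≬ (λ x → χ A x ≡ true) × O ≬ ∁ (λ x → χ A x ≡ true)
      dense-codense A A-meets {z} z∈U₀ O O-open z∈O =
        let n , z∈B , B⊆ = B-basis (O ∩ U₀) (open-∩ O-open U₀-open) (z∈O , z∈U₀)
            _ , D , A-ext = A-meets n
            (x , x∈B , x∈A) , (y , y∈B , y∉A) =
              proj₂ (D A A-ext) (proj₂ ∘ B⊆) (z , z∈B) in
        (x , proj₁ (B⊆ x∈B) , χ⁺ A x∈A) , (y , proj₁ (B⊆ y∈B) , y∉A ∘ χ⁻ A)

  𝓜-closed-or-not-Π⁰₂ : SecondCountable X →
    TopologicalSpace.Open (𝒫 X) (∁ (𝓜 X)) ⊎ ¬ Π⁰ (𝒫 X) 2 (𝓜 X)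
  𝓜-closed-or-not-Π⁰₂ sc
    with em {∃[ U ] NonemptyOpen U × (∀ V → Atom V → ¬ V ⊆ U)}
  ... | yes (U , U≠∅ , atomless) = inj₂ (atomless⇒𝓜-not-Π⁰₂ atomless sc U≠∅)
  ... | no ¬atomless = inj₁ (atomic⇒𝓜-closed λ U U≠∅ →
    decidable-stable (em {∃[ V ] Atom V × V ⊆ U}) λ ¬atom →
      ¬atomless (U , U≠∅ , λ V V-atom V⊆U → ¬atom (V , V-atom , V⊆U)))

corollary3p8 : ExcludedMiddle (suc 0ℓ) → Extensionality 0ℓ 0ℓ →
    (X : TopologicalSpace 0ℓ) → TopologicalSpace.Carrier X ⤖ ℕ → SecondCountable X →
    ¬ Complete (λ Y → Σ⁰ Y 1) (𝒫 X) (𝓜 X) ×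
    ¬ Δ⁰-Sharp (𝒫 X) 2 (𝓜 X) ×
    ¬ Complete (λ Y → Π⁰ Y 2) (𝒫 X) (𝓜 X)
corollary3p8 em _ X _ sc with 𝓜-closed-or-not-Π⁰₂ em X sc
-- A closed set is `Π⁰` at level 1, which rules out sharpness; for the hardness claims, `Isolated`
-- is open and hence also `Π⁰` at level 2.
... | inj₁ closed =
  (λ (_ , hard) → hard⇒¬closed (λ Y → Σ⁰ Y 1) (𝒫 X) (em₀ em X) isolated-Σ⁰₁ hard closed) ,
  (λ (_ , sharp) → sharp 1 ℕ.≤-refl (inj₂ (isOpen closed))) ,
  (λ (_ , hard) →
    hard⇒¬closed (λ Y → Π⁰ Y 2) (𝒫 X) (em₀ em X) (Σ⁰₁⇒Π⁰₂ em isolated-Σ⁰₁) hard closed)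
-- Each of the three properties would put `𝓜 X` in `Π⁰` at level 2.
... | inj₂ ¬Π⁰₂ =
  (λ (𝓜-Σ⁰₁ , _) → ¬Π⁰₂ (Σ⁰₁⇒Π⁰₂ em 𝓜-Σ⁰₁)) ,
  (λ ((_ , 𝓜-Π⁰₂) , _) → ¬Π⁰₂ 𝓜-Π⁰₂) ,
  (λ (𝓜-Π⁰₂ , _) → ¬Π⁰₂ 𝓜-Π⁰₂)
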